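{- For interval selection with unit weights and revocable acceptances, for every instance, every arrival order, every fixed optimal solution used as reference, and every assignment of binary predictions with total error $\eta$ (measured with respect to that optimal solution), Algorithm Revoke-Unit outputs a set of pairwise disjoint intervals of total weight $ALG \geq OPT - \eta$.
   Context: Interval selection: an instance is a finite nonempty set $\mathcal{I}$ of intervals $[s_i,f_i)$ on the real line, $s_i<f_i$, arriving one at a time in an arbitrary (adversarial) order. Two intervals conflict if they intersect; a conflict is either a proper inclusion (one interval is properly contained in the other) or a partial conflict (they intersect and neither contains the other). Each interval $I$ has a weight $w(I)$; unit weights means $w(I)=1$ for all $I$. The goal is to output a set of pairwise disjoint intervals of maximum total weight. $OPT$ denotes the maximum total weight of a set of pairwise disjoint intervals of the instance, and $ALG$ the total weight of the algorithm's final solution. Revocable acceptances: a newly arrived interval may be accepted by discarding all conflicting intervals in the current solution; rejected or discarded intervals can never be used again. Predictions: each interval $I$ arrives together with a bit $Prd(I)\in\{0,1\}$; $Prd(I)=1$ means $I$ is predicted to belong to a fixed optimal solution $O$, and $Prd(I)=0$ means it is predicted not to belong to $O$. The prediction of $I$ is accurate if ($Prd(I)=1 \iff I\in O$). Predictions may be arbitrary. Error (with respect to $O$, which may be any optimal solution): $\eta(I)=0$ if the prediction of $I$ is accurate; $\eta(I)=w(I)$ if $I\in O$ and $Prd(I)=0$; $\eta(I)=\sum_{J\in\mathcal{C}}w(J)-w(I)$ if $I\notin O$ and $Prd(I)=1$, where $\mathcal{C}$ is the set of intervals of $O$ that conflict with $I$. The total error is $\eta=\sum_{I\in\mathcal{I}}\eta(I)$.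 Algorithm Revoke-Unit: maintain a solution set $S$ and a set $M$ of marked intervals, both initially empty. On the arrival of $I$, let $I_s$ be the set of intervals of $S$ conflicting with $I$. (1) If $I_s=\emptyset$, add $I$ to $S$. If $I_s=\{I'\}$ and $I\subset I'$ (proper inclusion), replace $I'$ by $I$ in $S$, and if $I'\in M$ also add $I$ to $M$. (2) Otherwise, if $I$ is only involved in partial conflicts with the intervals of $I_s$, and $Prd(I)=1$, and $I_s\cap M=\emptyset$, then set $S\gets (S\cup\{I\})\setminus I_s$ and add $I$ to $M$. (3) Otherwise reject $I$. -}

module Defs where

open import Level using (Level; _⊔_)
import Algebra.Properties.CommutativeMonoid.Sum
open import Data.Bool using (Bool; true; false; if_then_else_)
import Data.Bool.Properties as Bool
open import Data.Fin using (Fin)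
open import Data.Fin.Properties using (any?)
open import Data.Fin.Subset
  using (Subset; Empty; Lift; ⊥; ⁅_⁆; _∈_; _∩_; _∪_; _─_)
  renaming (_-_ to _∖_)
open import Data.Fin.Subset.Properties using (_∈?_; nonempty?; Lift?)
open import Data.Integer using (ℤ; 0ℤ; 1ℤ; _-_; _≤_)
open import Data.Integer.Properties using (+-0-commutativeMonoid)
open import Data.List using (foldl; allFin)
open import Data.Nat using (ℕ; NonZero)
open import Data.Product using (_×_; _,_; proj₁; proj₂; ∃)
open import Data.Sum using (inj₁; inj₂)
open import Data.Vec using (lookup; tabulate)
open import Data.Vec.Properties using (≡-dec)
open import Relation.Binary.Bundles using (StrictTotalOrder)
open import Relation.Binary.Definitions using (tri<; tri≈; tri>)
import Relation.Binary.Properties.StrictTotalOrder as STO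
open import Relation.Binary.PropositionalEquality using (_≡_; _≢_)
open import Relation.Nullary using (Dec; yes; no; ¬_; does)
open import Relation.Nullary.Decidable using (map′; ¬?; _×-dec_)
open import Relation.Nullary.Negation using (contradiction)
open import Relation.Unary as Pred using (Pred; _≬_)

module ℤ-Sum = Algebra.Properties.CommutativeMonoid.Sum +-0-commutativeMonoid

private
  variable
    c ℓ₁ ℓ₂ : Level

-- The endpoints live on an arbitrary linear order with decidable comparison,
-- of which the real line is the intended instance: the algorithm can only
-- compare endpoints, and no arithmetic on them is involved.
module Geometry (Line : StrictTotalOrder c ℓ₁ ℓ₂) where

  open StrictTotalOrder Line using (Carrier; _<_; _<?_; compare; <-respˡ-≈; module Eq)
    renaming (trans to <-trans)
  open STO Line using () renaming (_≤_ to _≤ₚ_; _≤?_ to _≤ₚ?_)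

  record Interval : Set (c ⊔ ℓ₂) where
    field
      start  : Carrier
      finish : Carrier
      start<finish : start < finish

  open Interval public

  ⟦_⟧ : Interval → Pred Carrier (ℓ₁ ⊔ ℓ₂)
  ⟦ I ⟧ x = start I ≤ₚ x × x < finish I

  Conflict : Interval → Interval → Set (c ⊔ ℓ₁ ⊔ ℓ₂)
  Conflict I J = ⟦ I ⟧ ≬ ⟦ J ⟧

  PartialConflict : Interval → Interval → Set (c ⊔ ℓ₁ ⊔ ℓ₂)
  PartialConflict I J =
    Conflict I J × ⟦ I ⟧ Pred.⊈ ⟦ J ⟧ × ⟦ J ⟧ Pred.⊈ ⟦ I ⟧

  private
    ≤-<-trans : ∀ {x y z} → x ≤ₚ y → y < z → x < z
    ≤-<-trans (inj₁ x<y) y<z = <-trans x<y y<z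
    ≤-<-trans (inj₂ x≈y) y<z = <-respˡ-≈ (Eq.sym x≈y) y<z

    ≤-trans : ∀ {x y z} → x ≤ₚ y → y ≤ₚ z → x ≤ₚ z
    ≤-trans = STO.trans Line

    ≤-refl : ∀ {x} → x ≤ₚ x
    ≤-refl = inj₂ Eq.refl

  conflict⁺ : ∀ I J → start I < finish J → start J < finish I → Conflict I J
  conflict⁺ I J sI<fJ sJ<fI with compare (start I) (start J)
  ... | tri< sI<sJ _ _ = start J , (inj₁ sI<sJ , sJ<fI) , (≤-refl , start<finish J)
  ... | tri≈ _ sI≈sJ _ = start J , (inj₂ sI≈sJ , sJ<fI) , (≤-refl , start<finish J)
  ... | tri> _ _ sJ<sI = start I , (≤-refl , start<finish I) , (inj₁ sJ<sI , sI<fJ)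

  conflict⁻ : ∀ I J → Conflict I J → start I < finish J × start J < finish I
  conflict⁻ I J (x , (sI≤x , x<fI) , (sJ≤x , x<fJ)) =
    ≤-<-trans sI≤x x<fJ , ≤-<-trans sJ≤x x<fI

  ⊆⁺ : ∀ I J → start J ≤ₚ start I → finish I ≤ₚ finish J → ⟦ I ⟧ Pred.⊆ ⟦ J ⟧
  ⊆⁺ I J sJ≤sI fI≤fJ (sI≤x , x<fI) = ≤-trans sJ≤sI sI≤x , <-≤-trans x<fI fI≤fJ
    where
    <-≤-trans : ∀ {x y z} → x < y → y ≤ₚ z → x < z
    <-≤-trans x<y (inj₁ y<z) = <-trans x<y y<z
    <-≤-trans x<y (inj₂ y≈z) = StrictTotalOrder.<-respʳ-≈ Line y≈z x<y

  ⊆⁻ : ∀ I J → ⟦ I ⟧ Pred.⊆ ⟦ J ⟧ → start J ≤ₚ start I × finish I ≤ₚ finish J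
  ⊆⁻ I J I⊆J = proj₁ (I⊆J sI∈I) , fI≤fJ
    where
    sI∈I : ⟦ I ⟧ (start I)
    sI∈I = ≤-refl , start<finish I

    fI≤fJ : finish I ≤ₚ finish J
    fI≤fJ with compare (finish I) (finish J)
    ... | tri< fI<fJ _ _ = inj₁ fI<fJ
    ... | tri≈ _ fI≈fJ _ = inj₂ fI≈fJ
    ... | tri> _ _ fJ<fI =
      contradiction (proj₂ (I⊆J (inj₁ (proj₂ (I⊆J sI∈I)) , fJ<fI)))
                    (StrictTotalOrder.irrefl Line Eq.refl)

  conflict? : ∀ I J → Dec (Conflict I J)
  conflict? I J = map′ (λ (p , q) → conflict⁺ I J p q) (conflict⁻ I J)
    ((start I <? finish J) ×-dec (start J <? finish I))

  ⊆? : ∀ I J → Dec (⟦ I ⟧ Pred.⊆ ⟦ J ⟧)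
  ⊆? I J = map′ (λ (p , q) → ⊆⁺ I J p q) (⊆⁻ I J)
    ((start J ≤ₚ? start I) ×-dec (finish I ≤ₚ? finish J))

  ⊂? : ∀ I J → Dec (⟦ I ⟧ Pred.⊂ ⟦ J ⟧)
  ⊂? I J = ⊆? I J ×-dec ¬? (⊆? J I)

  partialConflict? : ∀ I J → Dec (PartialConflict I J)
  partialConflict? I J = conflict? I J ×-dec ¬? (⊆? I J) ×-dec ¬? (⊆? J I)

-- A finite nonempty set of intervals together with an arrival order:
-- interval i arrives before interval j when i < j in Fin size.
record Instance (Line : StrictTotalOrder c ℓ₁ ℓ₂) : Set (c ⊔ ℓ₁ ⊔ ℓ₂) where
  open Geometry Line
  field
    size     : ℕ
    nonempty : NonZero size
    interval : Fin size → Interval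
    distinct : ∀ {i j} → ⟦ interval i ⟧ Pred.≐ ⟦ interval j ⟧ → i ≡ j

open Instance public

unit : ∀ {n} → Fin n → ℤ
unit _ = 1ℤ

weight : ∀ {n} → (Fin n → ℤ) → Subset n → ℤ
weight w T = ℤ-Sum.sum (λ i → if lookup T i then w i else 0ℤ)

module _ {Line : StrictTotalOrder c ℓ₁ ℓ₂} (inst : Instance Line) where

  open Geometry Line

  private
    n : ℕ
    n = size inst

    ⟪_⟫ : Fin n → Pred (StrictTotalOrder.Carrier Line) (ℓ₁ ⊔ ℓ₂)
    ⟪ i ⟫ = ⟦ interval inst i ⟧

  PairwiseDisjoint : Subset n → Set (c ⊔ ℓ₁ ⊔ ℓ₂)
  PairwiseDisjoint T =
    ∀ {i j} → i ∈ T → j ∈ T → i ≢ j → ¬ Conflict (interval inst i) (interval inst j)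

  IsOptimal : (Fin n → ℤ) → Subset n → Set (c ⊔ ℓ₁ ⊔ ℓ₂)
  IsOptimal w T =
    PairwiseDisjoint T × (∀ U → PairwiseDisjoint U → weight w U ≤ weight w T)

  IsOPT : (Fin n → ℤ) → ℤ → Set (c ⊔ ℓ₁ ⊔ ℓ₂)
  IsOPT w opt = ∃ λ T → IsOptimal w T × weight w T ≡ opt

  -- Would contain i itself if i ∈ T; it is only used with i ∉ T.
  conflictsIn : Subset n → Fin n → Subset n
  conflictsIn T i = tabulate λ j →
    if lookup T j then does (conflict? (interval inst i) (interval inst j)) else false

  errorAt : (w : Fin n → ℤ) (O : Subset n) (Prd : Fin n → Bool) → Fin n → ℤ
  errorAt w O Prd i with lookup O i | Prd i
  ... | true  | true  = 0ℤ
  ... | false | false = 0ℤ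
  ... | true  | false = w i
  ... | false | true  = weight w (conflictsIn O i) - w i

  error : (w : Fin n → ℤ) (O : Subset n) (Prd : Fin n → Bool) → ℤ
  error w O Prd = ℤ-Sum.sum (errorAt w O Prd)

  -- The solution set S and the set M of marked intervals.
  State : Set
  State = Subset n × Subset n

  module _ (Prd : Fin n → Bool) where

    InsideUnique : Subset n → Fin n → Set (c ⊔ ℓ₁ ⊔ ℓ₂)
    InsideUnique Iₛ i = ∃ λ i′ → Iₛ ≡ ⁅ i′ ⁆ × ⟪ i ⟫ Pred.⊂ ⟪ i′ ⟫

    insideUnique? : ∀ Iₛ i → Dec (InsideUnique Iₛ i)
    insideUnique? Iₛ i = any? λ i′ →
      ≡-dec Bool._≟_ Iₛ ⁅ i′ ⁆ ×-dec ⊂? (interval inst i) (interval inst i′)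

    Revoking : Subset n → Subset n → Fin n → Set (c ⊔ ℓ₁ ⊔ ℓ₂)
    Revoking Iₛ M i =
        Lift (λ j → PartialConflict (interval inst i) (interval inst j)) Iₛ
      × Prd i ≡ true
      × Empty (Iₛ ∩ M)

    revoking? : ∀ Iₛ M i → Dec (Revoking Iₛ M i)
    revoking? Iₛ M i =
            Lift? (λ j → partialConflict? (interval inst i) (interval inst j)) Iₛ
      ×-dec Prd i Bool.≟ true
      ×-dec ¬? (nonempty? (Iₛ ∩ M))

    -- M keeps marked intervals that have left S: it is only ever consulted
    -- about members of S.
    process : (Iₛ : Subset n) → State → Fin n → State
    process Iₛ (S , M) i with nonempty? Iₛ
    ... | no  _ = S ∪ ⁅ i ⁆ , M
    ... | yes _ with insideUnique? Iₛ i
    ...   | yes (i′ , _) =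
              (S ∖ i′) ∪ ⁅ i ⁆ , (if does (i′ ∈? M) then M ∪ ⁅ i ⁆ else M)
    ...   | no  _ with revoking? Iₛ M i
    ...     | yes _ = (S ∪ ⁅ i ⁆) ─ Iₛ , M ∪ ⁅ i ⁆
    ...     | no  _ = S , M

    arrive : State → Fin n → State
    arrive (S , M) i = process (conflictsIn S i) (S , M) i

    revokeUnit : Subset n
    revokeUnit = proj₁ (foldl arrive (⊥ , ⊥) (allFin n))

{-# OPTIONS --safe #-}
-- Every member of the running solution descends, by successive shrinkings, from
-- an interval that was accepted freely or by revoking.  Call it bad if that
-- ancestor is a revoking interval r outside O.  Bad members are marked, hence
-- never revoked, so every such r keeps a descendant; together with its error
-- |C(r)| − 1 this pays for all intervals of O that conflict with r.  A rejected
-- interval of O predicted 0 is paid for by its own error.  Any other interval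
-- of O contains, from its arrival on, a member that is not bad; intervals of O
-- being disjoint, distinct ones contain distinct members.
module Submission where

open import Defs
open import Data.Bool using (Bool; true; false; if_then_else_)
open import Data.Fin using (Fin; zero; suc)
open import Data.Fin.Properties using (_≟_; any?; suc-injective)
open import Data.Fin.Subset
  using (Subset; inside; outside; ⊥; ⁅_⁆; _∈_; _∉_; _⊆_; _∩_; _∪_; _─_; ∣_∣)
  renaming (_-_ to _∖_)
open import Data.Fin.Subset.Properties
open import Data.Integer using (ℤ; +_; 0ℤ; 1ℤ; _+_; _-_; -_; _≤_; _≥_; +≤+; drop‿+≤+)
import Data.Integer.Properties as ℤ
open import Data.Integer.Tactic.RingSolver using (solve-∀)
open import Data.List using (List; []; _∷_; foldl; foldr; allFin; tabulate)
open import Data.List.Membership.Propositional using () renaming (_∈_ to _∈ᴸ_)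
open import Data.List.Membership.Propositional.Properties using (∈-allFin)
open import Data.List.Relation.Unary.All as All using (All; []; _∷_)
open import Data.List.Relation.Unary.AllPairs using ([]; _∷_)
open import Data.List.Relation.Unary.Any using (here; there)
open import Data.List.Relation.Unary.Unique.Propositional using (Unique)
open import Data.List.Relation.Unary.Unique.Propositional.Properties using (allFin⁺)
open import Data.Nat as ℕ using (ℕ; z≤n; s≤s)
import Data.Nat.Properties as ℕ
open import Data.Product using (_×_; _,_; proj₁; proj₂; ∃; ∃₂)
open import Data.Sum using (_⊎_; inj₁; inj₂; [_,_]′)
open import Data.Vec using ([]; _∷_; lookup; here; there)
open import Data.Vec.Properties using ([]=⇒lookup; lookup⇒[]=; lookup∘tabulate)
open import Function using (_∘_; id)
open import Level using (_⊔_)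
open import Relation.Binary.Bundles using (StrictTotalOrder)
open import Relation.Binary.PropositionalEquality
open import Relation.Nullary using (Dec; yes; no; ¬_; does)
open import Relation.Nullary.Decidable using (dec-true; decidable-stable; _×-dec_)
open import Relation.Nullary.Negation using (contradiction)
import Relation.Unary as Pred

-- Cardinalities of finite subsets.

∣p∪q∣≤∣p∣+∣q∣ : ∀ {n} (p q : Subset n) → ∣ p ∪ q ∣ ℕ.≤ ∣ p ∣ ℕ.+ ∣ q ∣
∣p∪q∣≤∣p∣+∣q∣ [] [] = z≤n
∣p∪q∣≤∣p∣+∣q∣ (outside ∷ p) (outside ∷ q) = ∣p∪q∣≤∣p∣+∣q∣ p q
∣p∪q∣≤∣p∣+∣q∣ (inside ∷ p) (outside ∷ q) = s≤s (∣p∪q∣≤∣p∣+∣q∣ p q)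
∣p∪q∣≤∣p∣+∣q∣ (outside ∷ p) (inside ∷ q) =
  ℕ.≤-trans (s≤s (∣p∪q∣≤∣p∣+∣q∣ p q)) (ℕ.≤-reflexive (sym (ℕ.+-suc ∣ p ∣ ∣ q ∣)))
∣p∪q∣≤∣p∣+∣q∣ (inside ∷ p) (inside ∷ q) =
  s≤s (ℕ.≤-trans (∣p∪q∣≤∣p∣+∣q∣ p q) (ℕ.+-monoʳ-≤ ∣ p ∣ (ℕ.n≤1+n ∣ q ∣)))

∣p∩q∣+∣p─q∣≡∣p∣ : ∀ {n} (p q : Subset n) → ∣ p ∩ q ∣ ℕ.+ ∣ p ─ q ∣ ≡ ∣ p ∣
∣p∩q∣+∣p─q∣≡∣p∣ [] [] = refl
∣p∩q∣+∣p─q∣≡∣p∣ (outside ∷ p) (outside ∷ q) = ∣p∩q∣+∣p─q∣≡∣p∣ p q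
∣p∩q∣+∣p─q∣≡∣p∣ (outside ∷ p) (inside ∷ q) = ∣p∩q∣+∣p─q∣≡∣p∣ p q
∣p∩q∣+∣p─q∣≡∣p∣ (inside ∷ p) (outside ∷ q) =
  trans (ℕ.+-suc ∣ p ∩ q ∣ ∣ p ─ q ∣) (cong ℕ.suc (∣p∩q∣+∣p─q∣≡∣p∣ p q))
∣p∩q∣+∣p─q∣≡∣p∣ (inside ∷ p) (inside ∷ q) = cong ℕ.suc (∣p∩q∣+∣p─q∣≡∣p∣ p q)

x∈p─q⇒x∉q : ∀ {n x} (p q : Subset n) → x ∈ p ─ q → x ∉ q
x∈p─q⇒x∉q (_ ∷ p) (inside ∷ q) () here
x∈p─q⇒x∉q (_ ∷ p) (_ ∷ q) (there x∈p─q) (there x∈q) = x∈p─q⇒x∉q p q x∈p─q x∈q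

x∈p∖y⇒x≢y : ∀ {n x} (p : Subset n) y → x ∈ p ∖ y → x ≢ y
x∈p∖y⇒x≢y p y x∈p∖y refl = x∈p─q⇒x∉q p ⁅ y ⁆ x∈p∖y (x∈⁅x⁆ y)

x∉p⇒∣p∣<∣p∪⁅x⁆∣ : ∀ {n x} (p : Subset n) → x ∉ p → ∣ p ∣ ℕ.< ∣ p ∪ ⁅ x ⁆ ∣
x∉p⇒∣p∣<∣p∪⁅x⁆∣ {x = x} p x∉p =
  p⊂q⇒∣p∣<∣q∣ (p⊆p∪q ⁅ x ⁆ , x , q⊆p∪q p ⁅ x ⁆ (x∈⁅x⁆ x) , x∉p)

∣p∪⁅x⁆∣≤∣p∣+1 : ∀ {n} (p : Subset n) x → ∣ p ∪ ⁅ x ⁆ ∣ ℕ.≤ ∣ p ∣ ℕ.+ 1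
∣p∪⁅x⁆∣≤∣p∣+1 p x =
  ℕ.≤-trans (∣p∪q∣≤∣p∣+∣q∣ p ⁅ x ⁆) (ℕ.≤-reflexive (cong (∣ p ∣ ℕ.+_) (∣⁅x⁆∣≡1 x)))

-- At most one element is lost, and the new `y` makes up for it. This is why replacing a bad member
-- by a smaller interval does not lower the number of bad members.
∣p∣≤∣p∖x∪⁅y⁆∣ : ∀ {n} (p : Subset n) x {y} → y ∉ p → ∣ p ∣ ℕ.≤ ∣ (p ∖ x) ∪ ⁅ y ⁆ ∣
∣p∣≤∣p∖x∪⁅y⁆∣ p x {y} y∉p = begin
  ∣ p ∣                              ≡⟨ ∣p∩q∣+∣p─q∣≡∣p∣ p ⁅ x ⁆ ⟨
  ∣ p ∩ ⁅ x ⁆ ∣ ℕ.+ ∣ p ∖ x ∣        ≤⟨ ℕ.+-monoˡ-≤ ∣ p ∖ x ∣ (∣p∩q∣≤∣q∣ p ⁅ x ⁆) ⟩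
  ∣ ⁅ x ⁆ ∣ ℕ.+ ∣ p ∖ x ∣            ≡⟨ cong (ℕ._+ ∣ p ∖ x ∣) (∣⁅x⁆∣≡1 x) ⟩
  ℕ.suc ∣ p ∖ x ∣                    ≤⟨ x∉p⇒∣p∣<∣p∪⁅x⁆∣ (p ∖ x) (y∉p ∘ p─q⊆p p ⁅ x ⁆) ⟩
  ∣ (p ∖ x) ∪ ⁅ y ⁆ ∣                ∎
  where open ℕ.≤-Reasoning

-- The induction removes the first element of `p` and deletes its partner `y₀` from `q`. Injectivity
-- keeps every other partner different from `y₀`, so the remaining pairs survive the deletion.
injection⇒∣p∣≤∣q∣ : ∀ {m n ℓ} (R : Fin m → Fin n → Set ℓ) →
  (∀ {x x′ y} → R x y → R x′ y → x ≡ x′) →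
  (p : Subset m) (q : Subset n) →
  (∀ {x} → x ∈ p → ∃ λ y → y ∈ q × R x y) → ∣ p ∣ ℕ.≤ ∣ q ∣
injection⇒∣p∣≤∣q∣ R inj [] q f = z≤n
injection⇒∣p∣≤∣q∣ R inj (outside ∷ p) q f =
  injection⇒∣p∣≤∣q∣ (R ∘ suc) (λ r r′ → suc-injective (inj r r′)) p q (f ∘ there)
injection⇒∣p∣≤∣q∣ R inj (inside ∷ p) q f with f here
... | y₀ , y₀∈q , R₀ =
  ℕ.≤-trans (s≤s (injection⇒∣p∣≤∣q∣ (R ∘ suc) (λ r r′ → suc-injective (inj r r′)) p (q ∖ y₀) g))
            (x∈p⇒∣p-x∣<∣p∣ y₀∈q)
  where
  g : ∀ {x} → x ∈ p → ∃ λ y → y ∈ q ∖ y₀ × R (suc x) y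
  g x∈p with f (there x∈p)
  ... | y , y∈q , Rxy =
    y , x∈p∧x≢y⇒x∈p-y y∈q (λ { refl → contradiction (inj R₀ Rxy) λ () }) , Rxy

-- Unit weights and sums of errors.

weight-unit : ∀ {n} (p : Subset n) → weight unit p ≡ + ∣ p ∣
weight-unit [] = refl
weight-unit (inside ∷ p) = cong (_+_ 1ℤ) (weight-unit p)
weight-unit (outside ∷ p) = trans (ℤ.+-identityˡ _) (weight-unit p)

-- The run is a fold over a list of arrivals, so its errors accumulate along a list.
-- `listSum-tabulate` identifies the total over `allFin` with the sum over `Fin` that defines
-- `error`.
listSum : ∀ {a} {X : Set a} → (X → ℤ) → List X → ℤ
listSum f = foldr (λ x → _+_ (f x)) 0ℤ

listSum-tabulate : ∀ {a} {X : Set a} {n} (f : X → ℤ) (g : Fin n → X) →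
  listSum f (tabulate g) ≡ ℤ-Sum.sum (f ∘ g)
listSum-tabulate {n = ℕ.zero} f g = refl
listSum-tabulate {n = ℕ.suc n} f g = cong (_+_ (f (g zero))) (listSum-tabulate f (g ∘ suc))

-- Conflict, inclusion and disjointness of intervals.

module _ {c ℓ₁ ℓ₂} {Line : StrictTotalOrder c ℓ₁ ℓ₂} (inst : Instance Line) where

  open Geometry Line

  private
    n : ℕ
    n = size inst

  infix 4 _#_ _⊑_

  _#_ : Fin n → Fin n → Set _
  i # j = Conflict (interval inst i) (interval inst j)

  _⊑_ : Fin n → Fin n → Set _
  i ⊑ j = ⟦ interval inst i ⟧ Pred.⊆ ⟦ interval inst j ⟧

  #-refl : ∀ i → i # i
  #-refl i = conflict⁺ I I (start<finish I) (start<finish I)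
    where I = interval inst i

  #-sym : ∀ i j → i # j → j # i
  #-sym i j (x , x∈i , x∈j) = x , x∈j , x∈i

  #-mono : ∀ i i′ j → i ⊑ i′ → i # j → i′ # j
  #-mono i i′ j i⊑i′ (x , x∈i , x∈j) = x , i⊑i′ x∈i , x∈j

  ⊑⇒# : ∀ i j → i ⊑ j → i # j
  ⊑⇒# i j i⊑j = #-sym j i (#-mono i j i i⊑j (#-refl i))

  disjoint⇒≡ : ∀ {T i j} → PairwiseDisjoint inst T → i ∈ T → j ∈ T → i # j → i ≡ j
  disjoint⇒≡ {i = i} {j} disj i∈T j∈T i#j =
    decidable-stable (i ≟ j) λ i≢j → disj i∈T j∈T i≢j i#j

  ∈-conflictsIn⁺ : ∀ T i {j} → j ∈ T → i # j → j ∈ conflictsIn inst T i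
  ∈-conflictsIn⁺ T i {j} j∈T i#j = lookup⇒[]= j _ (trans (lookup∘tabulate _ j) eq)
    where
    eq : (if lookup T j then does (conflict? (interval inst i) (interval inst j)) else false) ≡ true
    eq rewrite []=⇒lookup j∈T = dec-true (conflict? (interval inst i) (interval inst j)) i#j

  ∈-conflictsIn⁻ : ∀ T i {j} → j ∈ conflictsIn inst T i → j ∈ T × i # j
  ∈-conflictsIn⁻ T i {j} j∈C =
    split (lookup T j) (conflict? (interval inst i) (interval inst j)) refl
      (trans (sym (lookup∘tabulate _ j)) ([]=⇒lookup j∈C))
    where
    split : ∀ b (d : Dec (i # j)) → lookup T j ≡ b →
      (if b then does d else false) ≡ true → j ∈ T × i # j
    split true (yes i#j) j∈T _ = lookup⇒[]= j T j∈T , i#j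
    split true (no _) _ ()
    split false _ _ ()

  disjoint-∪⁅⁆ : ∀ T i → PairwiseDisjoint inst T → (∀ {j} → j ∈ T → ¬ i # j) →
    PairwiseDisjoint inst (T ∪ ⁅ i ⁆)
  disjoint-∪⁅⁆ T i disj free {j} {k} j∈ k∈ j≢k j#k
    with x∈p∪q⁻ T ⁅ i ⁆ j∈ | x∈p∪q⁻ T ⁅ i ⁆ k∈
  ... | inj₁ j∈T | inj₁ k∈T = disj j∈T k∈T j≢k j#k
  ... | inj₁ j∈T | inj₂ k∈i with refl ← x∈⁅y⁆⇒x≡y i k∈i = free j∈T (#-sym j k j#k)
  ... | inj₂ j∈i | inj₁ k∈T with refl ← x∈⁅y⁆⇒x≡y i j∈i = free k∈T j#k
  ... | inj₂ j∈i | inj₂ k∈i = j≢k (trans (x∈⁅y⁆⇒x≡y i j∈i) (sym (x∈⁅y⁆⇒x≡y i k∈i)))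

  disjoint-⊆ : ∀ {T U} → T ⊆ U → PairwiseDisjoint inst U → PairwiseDisjoint inst T
  disjoint-⊆ T⊆U disj i∈T j∈T = disj (T⊆U i∈T) (T⊆U j∈T)

  -- Errors relative to a fixed optimal solution, and the accounting built on them.

  module _ (O : Subset n) (O-optimal : IsOptimal inst unit O) (Prd : Fin n → Bool) where

    private
      O-disjoint : PairwiseDisjoint inst O
      O-disjoint = proj₁ O-optimal

      η : Fin n → ℤ
      η = errorAt inst unit O Prd

    -- Otherwise `O ∪ ⁅ i ⁆` would be pairwise disjoint and larger than the optimal `O`.
    optimal⇒maximal : ∀ {i} → i ∉ O → 1 ℕ.≤ ∣ conflictsIn inst O i ∣
    optimal⇒maximal {i} i∉O with nonempty? (conflictsIn inst O i)
    ... | yes (j , j∈C) = subst (ℕ._≤ _) (∣⁅x⁆∣≡1 j)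
      (p⊆q⇒∣p∣≤∣q∣ λ k∈j → subst (_∈ conflictsIn inst O i) (sym (x∈⁅y⁆⇒x≡y j k∈j)) j∈C)
    ... | no C-empty = contradiction (x∉p⇒∣p∣<∣p∪⁅x⁆∣ O i∉O) (ℕ.≤⇒≯ larger)
      where
      larger : ∣ O ∪ ⁅ i ⁆ ∣ ℕ.≤ ∣ O ∣
      larger = drop‿+≤+ (subst₂ _≤_ (weight-unit (O ∪ ⁅ i ⁆)) (weight-unit O)
        (proj₂ O-optimal (O ∪ ⁅ i ⁆)
          (disjoint-∪⁅⁆ O i O-disjoint λ j∈O i#j → C-empty (_ , ∈-conflictsIn⁺ O i j∈O i#j))))

    η-missed : ∀ {i} → i ∈ O → Prd i ≡ false → η i ≡ 1ℤ
    η-missed i∈O ¬prd rewrite []=⇒lookup i∈O | ¬prd = refl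

    η-wrong : ∀ {i} → i ∉ O → Prd i ≡ true → η i ≡ + ∣ conflictsIn inst O i ∣ - 1ℤ
    η-wrong {i} i∉O prd with lookup O i in eq | Prd i
    η-wrong {i} i∉O refl | true | true = contradiction (lookup⇒[]= i O eq) i∉O
    η-wrong {i} i∉O refl | false | true =
      cong (_- 1ℤ) (weight-unit (conflictsIn inst O i))

    -- Only a false positive could have a negative error, namely if it met nothing in `O`;
    -- `optimal⇒maximal` rules this out. Arrivals that pay for nothing new may therefore ignore
    -- their error.
    η≥0 : ∀ i → 0ℤ ≤ η i
    η≥0 i with lookup O i in eq | Prd i
    ... | true  | true  = ℤ.≤-refl
    ... | false | false = ℤ.≤-refl
    ... | true  | false = +≤+ z≤n
    ... | false | true  = ℤ.i≤j⇒0≤j-i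
      (subst (1ℤ ≤_) (sym (weight-unit (conflictsIn inst O i))) (+≤+ (optimal⇒maximal i∉O)))
      where
      i∉O : i ∉ O
      i∉O i∈O = contradiction (trans (sym ([]=⇒lookup i∈O)) eq) λ ()

    -- A collects the bad members of the solution, T the intervals of O whose
    -- loss is paid for; rest lists the intervals still to arrive.
    record Invariant (rest : List (Fin n)) (σ : State inst) (T A : Subset n) :
      Set (c ⊔ ℓ₁ ⊔ ℓ₂) where
      S = proj₁ σ
      M = proj₂ σ
      field
        disjoint : PairwiseDisjoint inst S
        fresh    : ∀ {x} → x ∈ᴸ rest → x ∉ M
        A⊆S      : A ⊆ S
        A⊆M      : A ⊆ M
        paid     : ∀ {x o} → x ∈ A → o ∈ O → x # o → o ∈ T
        good     : ∀ {x} → x ∈ S → x ∈ M → x ∉ A → ∃ λ o → o ∈ O × x ⊑ o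
        covered  : ∀ {o} → o ∈ O →
                   o ∈ᴸ rest ⊎ o ∈ T ⊎ ∃ λ x → x ∈ S × x ∉ A × x ⊑ o

    -- Rearranged without subtraction, this says that `∣ T ∣ - ∣ A ∣` grows by at most `e`: each
    -- interval newly put into `T` is charged either to the error or to a new bad member.
    Paid : ℤ → (T A T′ A′ : Subset n) → Set
    Paid e T A T′ A′ = + ∣ T′ ∣ + + ∣ A ∣ ≤ (+ ∣ T ∣ + + ∣ A′ ∣) + e

    Paid-refl : ∀ T A → Paid 0ℤ T A T A
    Paid-refl T A = ℤ.≤-reflexive (sym (ℤ.+-identityʳ _))

    -- The growth of `∣ T ∣ - ∣ A ∣` telescopes; the terms added and cancelled only bring each side
    -- into a shape to which `q` and then `p` apply.
    Paid-trans : ∀ e e′ T A T′ A′ T″ A″ →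
      Paid e T A T′ A′ → Paid e′ T′ A′ T″ A″ → Paid (e + e′) T A T″ A″
    Paid-trans e e′ T A T′ A′ T″ A″ p q = begin
      t″ + a                           ≡⟨ lem₁ t″ a a′ ⟩
      (t″ + a′) + (a - a′)             ≤⟨ ℤ.+-monoˡ-≤ (a - a′) q ⟩
      ((t′ + a″) + e′) + (a - a′)      ≡⟨ lem₂ t′ a″ e′ a a′ ⟩
      (t′ + a) + ((a″ + e′) - a′)      ≤⟨ ℤ.+-monoˡ-≤ ((a″ + e′) - a′) p ⟩
      ((t + a′) + e) + ((a″ + e′) - a′) ≡⟨ lem₃ t a′ e a″ e′ ⟩
      (t + a″) + (e + e′)              ∎
      where
      open ℤ.≤-Reasoning
      t  = + ∣ T ∣
      a  = + ∣ A ∣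
      t′ = + ∣ T′ ∣
      a′ = + ∣ A′ ∣
      t″ = + ∣ T″ ∣
      a″ = + ∣ A″ ∣
      lem₁ : ∀ t″ a a′ → t″ + a ≡ (t″ + a′) + (a - a′)
      lem₁ = solve-∀
      lem₂ : ∀ t′ a″ e′ a a′ → ((t′ + a″) + e′) + (a - a′) ≡ (t′ + a) + ((a″ + e′) - a′)
      lem₂ = solve-∀
      lem₃ : ∀ t a′ e a″ e′ → ((t + a′) + e) + ((a″ + e′) - a′) ≡ (t + a″) + (e + e′)
      lem₃ = solve-∀

    Paid-free : ∀ T A A′ i → ∣ A ∣ ℕ.≤ ∣ A′ ∣ → Paid (η i) T A T A′
    Paid-free T A A′ i A≤A′ = begin
      + ∣ T ∣ + + ∣ A ∣           ≤⟨ ℤ.+-monoʳ-≤ (+ ∣ T ∣) (+≤+ A≤A′) ⟩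
      + ∣ T ∣ + + ∣ A′ ∣          ≡⟨ ℤ.+-identityʳ _ ⟨
      + ∣ T ∣ + + ∣ A′ ∣ + 0ℤ     ≤⟨ ℤ.+-monoʳ-≤ (+ ∣ T ∣ + + ∣ A′ ∣) (η≥0 i) ⟩
      + ∣ T ∣ + + ∣ A′ ∣ + η i    ∎
      where open ℤ.≤-Reasoning

    -- A false negative has error 1, exactly the price of adding the interval itself to `T`.
    Paid-missed : ∀ T A i → i ∈ O → Prd i ≡ false → Paid (η i) T A (T ∪ ⁅ i ⁆) A
    Paid-missed T A i i∈O ¬prd rewrite η-missed i∈O ¬prd = begin
      + ∣ T ∪ ⁅ i ⁆ ∣ + + ∣ A ∣    ≤⟨ ℤ.+-monoˡ-≤ (+ ∣ A ∣) (+≤+ (∣p∪⁅x⁆∣≤∣p∣+1 T i)) ⟩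
      + ∣ T ∣ + 1ℤ + + ∣ A ∣       ≡⟨ lem (+ ∣ T ∣) (+ ∣ A ∣) ⟩
      + ∣ T ∣ + + ∣ A ∣ + 1ℤ       ∎
      where
      open ℤ.≤-Reasoning
      lem : ∀ t a → t + 1ℤ + a ≡ t + a + 1ℤ
      lem = solve-∀

    -- The error `∣ C ∣ - 1` pays for all conflicting intervals of `O` but one. The last one is
    -- charged to `i` itself, which enlarges `A` and occupies a place in the solution.
    Paid-wrong : ∀ T A i → i ∉ O → Prd i ≡ true → i ∉ A →
      Paid (η i) T A (T ∪ conflictsIn inst O i) (A ∪ ⁅ i ⁆)
    Paid-wrong T A i i∉O prd i∉A rewrite η-wrong i∉O prd = begin
      + ∣ T ∪ C ∣ + + ∣ A ∣
        ≤⟨ ℤ.+-monoˡ-≤ (+ ∣ A ∣) (+≤+ (∣p∪q∣≤∣p∣+∣q∣ T C)) ⟩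
      + ∣ T ∣ + + ∣ C ∣ + + ∣ A ∣
        ≡⟨ lem (+ ∣ T ∣) (+ ∣ C ∣) (+ ∣ A ∣) ⟩
      + ∣ T ∣ + (1ℤ + + ∣ A ∣) + (+ ∣ C ∣ - 1ℤ)
        ≤⟨ ℤ.+-monoˡ-≤ (+ ∣ C ∣ - 1ℤ)
             (ℤ.+-monoʳ-≤ (+ ∣ T ∣) (+≤+ (x∉p⇒∣p∣<∣p∪⁅x⁆∣ A i∉A))) ⟩
      + ∣ T ∣ + + ∣ A ∪ ⁅ i ⁆ ∣ + (+ ∣ C ∣ - 1ℤ) ∎
      where
      open ℤ.≤-Reasoning
      C = conflictsIn inst O i
      lem : ∀ t c a → t + c + a ≡ t + (1ℤ + a) + (c - 1ℤ)
      lem = solve-∀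

    -- Preservation of the invariant by one arrival, beginning with free acceptance.

    module Arrival {rest : List (Fin n)} {i : Fin n} {S M T A : Subset n}
      (i∉rest : All (i ≢_) rest) (inv : Invariant (i ∷ rest) (S , M) T A) where

      open Invariant inv hiding (S; M)

      i∉M : i ∉ M
      i∉M = fresh (here refl)

      fresh-∪ : ∀ {x} → x ∈ᴸ rest → x ∉ M ∪ ⁅ i ⁆
      fresh-∪ x∈rest x∈ with x∈p∪q⁻ M ⁅ i ⁆ x∈
      ... | inj₁ x∈M = fresh (there x∈rest) x∈M
      ... | inj₂ x∈i = All.lookup i∉rest x∈rest (sym (x∈⁅y⁆⇒x≡y i x∈i))

      Next : State inst → Set _
      Next σ = ∃₂ λ T′ A′ → Invariant rest σ T′ A′ × Paid (η i) T A T′ A′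

      accept : (∀ {j} → j ∈ S → ¬ i # j) → Next (S ∪ ⁅ i ⁆ , M)
      accept free = T , A , record
        { disjoint = disjoint-∪⁅⁆ S i disjoint free
        ; fresh    = fresh ∘ there
        ; A⊆S      = p⊆p∪q ⁅ i ⁆ ∘ A⊆S
        ; A⊆M      = A⊆M
        ; paid     = paid
        ; good     = good′
        ; covered  = covered′
        } , Paid-free T A A i ℕ.≤-refl
        where
        i∉A : i ∉ A
        i∉A i∈A = free (A⊆S i∈A) (#-refl i)

        good′ : ∀ {x} → x ∈ S ∪ ⁅ i ⁆ → x ∈ M → x ∉ A → ∃ λ o → o ∈ O × x ⊑ o
        good′ x∈ x∈M x∉A with x∈p∪q⁻ S ⁅ i ⁆ x∈
        ... | inj₁ x∈S = good x∈S x∈M x∉A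
        -- Marks are only put on intervals that have arrived, so a freely accepted interval is
        -- unmarked.
        ... | inj₂ x∈i with refl ← x∈⁅y⁆⇒x≡y i x∈i = contradiction x∈M i∉M

        covered′ : ∀ {o} → o ∈ O →
          o ∈ᴸ rest ⊎ o ∈ T ⊎ ∃ λ x → x ∈ S ∪ ⁅ i ⁆ × x ∉ A × x ⊑ o
        covered′ o∈O with covered o∈O
        ... | inj₁ (here refl) = inj₂ (inj₂ (i , q⊆p∪q S ⁅ i ⁆ (x∈⁅x⁆ i) , i∉A , id))
        ... | inj₁ (there o∈rest) = inj₁ o∈rest
        ... | inj₂ (inj₁ o∈T) = inj₂ (inj₁ o∈T)
        ... | inj₂ (inj₂ (x , x∈S , x∉A , x⊑o)) =
          inj₂ (inj₂ (x , p⊆p∪q ⁅ i ⁆ x∈S , x∉A , x⊑o))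

      -- Replacement of a member by an interval properly inside it.

      module Shrink {i′} (i′∈S : i′ ∈ S) (i⊑i′ : i ⊑ i′) (i′⋢i : ¬ i′ ⊑ i)
        (only : ∀ {j} → j ∈ S → i # j → j ≡ i′) where

        -- Badness passes from `i′` to `i` as the mark does. Unlike `M`, the set `A` also drops
        -- `i′`, since it has to stay inside the solution.
        S′ M′ A′ : Subset n
        S′ = (S ∖ i′) ∪ ⁅ i ⁆
        M′ = if does (i′ ∈? M) then M ∪ ⁅ i ⁆ else M
        A′ = if does (i′ ∈? A) then (A ∖ i′) ∪ ⁅ i ⁆ else A

        -- The invariant does not record that future arrivals are outside `S`; here it follows from
        -- the inclusion being proper.
        i∉S : i ∉ S
        i∉S i∈S with refl ← only i∈S (#-refl i) = i′⋢i id

        i∈S′ : i ∈ S′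
        i∈S′ = q⊆p∪q (S ∖ i′) ⁅ i ⁆ (x∈⁅x⁆ i)

        keep : ∀ {x} → x ∈ S → x ≢ i′ → x ∈ S′
        keep x∈S x≢i′ = p⊆p∪q ⁅ i ⁆ (x∈p∧x≢y⇒x∈p-y x∈S x≢i′)

        S′-cases : ∀ {x} → x ∈ S′ → (x ∈ S × x ≢ i′) ⊎ x ≡ i
        S′-cases x∈S′ with x∈p∪q⁻ (S ∖ i′) ⁅ i ⁆ x∈S′
        ... | inj₁ x∈ = inj₁ (p─q⊆p S ⁅ i′ ⁆ x∈ , x∈p∖y⇒x≢y S i′ x∈)
        ... | inj₂ x∈i = inj₂ (x∈⁅y⁆⇒x≡y i x∈i)

        disjoint′ : PairwiseDisjoint inst S′
        disjoint′ = disjoint-∪⁅⁆ (S ∖ i′) i (disjoint-⊆ (p─q⊆p S ⁅ i′ ⁆) disjoint)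
          λ j∈ i#j → x∈p∖y⇒x≢y S i′ j∈ (only (p─q⊆p S ⁅ i′ ⁆ j∈) i#j)

        M-cases : ∀ {x} → x ∈ M′ → x ∈ M ⊎ (x ≡ i × i′ ∈ M)
        M-cases x∈M′ with i′ ∈? M
        ... | no _ = inj₁ x∈M′
        ... | yes i′∈M with x∈p∪q⁻ M ⁅ i ⁆ x∈M′
        ...   | inj₁ x∈M = inj₁ x∈M
        ...   | inj₂ x∈i = inj₂ (x∈⁅y⁆⇒x≡y i x∈i , i′∈M)

        M⊆M′ : M ⊆ M′
        M⊆M′ x∈M with i′ ∈? M
        ... | no _ = x∈M
        ... | yes _ = p⊆p∪q ⁅ i ⁆ x∈M

        i∈M′ : i′ ∈ M → i ∈ M′
        i∈M′ i′∈M with i′ ∈? M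
        ... | no i′∉M = contradiction i′∈M i′∉M
        ... | yes _ = q⊆p∪q M ⁅ i ⁆ (x∈⁅x⁆ i)

        A-cases : ∀ {x} → x ∈ A′ → (x ∈ A × x ≢ i′) ⊎ (x ≡ i × i′ ∈ A)
        A-cases x∈A′ with i′ ∈? A
        ... | no i′∉A = inj₁ (x∈A′ , λ { refl → i′∉A x∈A′ })
        ... | yes i′∈A with x∈p∪q⁻ (A ∖ i′) ⁅ i ⁆ x∈A′
        ...   | inj₁ x∈ = inj₁ (p─q⊆p A ⁅ i′ ⁆ x∈ , x∈p∖y⇒x≢y A i′ x∈)
        ...   | inj₂ x∈i = inj₂ (x∈⁅y⁆⇒x≡y i x∈i , i′∈A)

        A′⁺ : ∀ {x} → x ∈ A → x ≢ i′ → x ∈ A′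
        A′⁺ x∈A x≢i′ with i′ ∈? A
        ... | no _ = x∈A
        ... | yes _ = p⊆p∪q ⁅ i ⁆ (x∈p∧x≢y⇒x∈p-y x∈A x≢i′)

        i∈A′ : i′ ∈ A → i ∈ A′
        i∈A′ i′∈A with i′ ∈? A
        ... | no i′∉A = contradiction i′∈A i′∉A
        ... | yes _ = q⊆p∪q (A ∖ i′) ⁅ i ⁆ (x∈⁅x⁆ i)

        ∣A∣≤∣A′∣ : ∣ A ∣ ℕ.≤ ∣ A′ ∣
        ∣A∣≤∣A′∣ with i′ ∈? A
        ... | no _ = ℕ.≤-refl
        ... | yes _ = ∣p∣≤∣p∖x∪⁅y⁆∣ A i′ (i∉S ∘ A⊆S)

        fresh′ : ∀ {x} → x ∈ᴸ rest → x ∉ M′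
        fresh′ x∈rest x∈M′ with M-cases x∈M′
        ... | inj₁ x∈M = fresh (there x∈rest) x∈M
        ... | inj₂ (x≡i , _) = All.lookup i∉rest x∈rest (sym x≡i)

        A′⊆S′ : A′ ⊆ S′
        A′⊆S′ x∈A′ with A-cases x∈A′
        ... | inj₁ (x∈A , x≢i′) = keep (A⊆S x∈A) x≢i′
        ... | inj₂ (refl , _) = i∈S′

        A′⊆M′ : A′ ⊆ M′
        A′⊆M′ x∈A′ with A-cases x∈A′
        ... | inj₁ (x∈A , _) = M⊆M′ (A⊆M x∈A)
        ... | inj₂ (refl , i′∈A) = i∈M′ (A⊆M i′∈A)

        paid′ : ∀ {x o} → x ∈ A′ → o ∈ O → x # o → o ∈ T
        paid′ {o = o} x∈A′ o∈O x#o with A-cases x∈A′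
        ... | inj₁ (x∈A , _) = paid x∈A o∈O x#o
        -- Shrinking a bad member creates no new conflicts, so everything that `i` meets has been
        -- paid for on account of `i′`.
        ... | inj₂ (refl , i′∈A) = paid i′∈A o∈O (#-mono i i′ o i⊑i′ x#o)

        good′ : ∀ {x} → x ∈ S′ → x ∈ M′ → x ∉ A′ → ∃ λ o → o ∈ O × x ⊑ o
        good′ x∈S′ x∈M′ x∉A′ with S′-cases x∈S′ | M-cases x∈M′
        ... | inj₁ (x∈S , x≢i′) | inj₁ x∈M = good x∈S x∈M λ x∈A → x∉A′ (A′⁺ x∈A x≢i′)
        ... | inj₁ (x∈S , _) | inj₂ (refl , _) = contradiction x∈S i∉S
        ... | inj₂ refl | inj₁ i∈M = contradiction i∈M i∉M
        -- If `i` is not bad, neither was `i′`, and the interval of `O` around `i′` also contains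
        -- `i`.
        ... | inj₂ refl | inj₂ (_ , i′∈M) with good i′∈S i′∈M (x∉A′ ∘ i∈A′)
        ...   | o , o∈O , i′⊑o = o , o∈O , λ y∈i → i′⊑o (i⊑i′ y∈i)

        i∉A′ : i′ ∉ A → i ∉ A′
        i∉A′ i′∉A i∈A′ with A-cases i∈A′
        ... | inj₁ (i∈A , _) = i∉S (A⊆S i∈A)
        ... | inj₂ (_ , i′∈A) = i′∉A i′∈A

        covered′ : ∀ {o} → o ∈ O →
          o ∈ᴸ rest ⊎ o ∈ T ⊎ ∃ λ x → x ∈ S′ × x ∉ A′ × x ⊑ o
        covered′ o∈O with covered o∈O
        ... | inj₁ (there o∈rest) = inj₁ o∈rest
        ... | inj₂ (inj₁ o∈T) = inj₂ (inj₁ o∈T)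
        -- When `i` belongs to `O` but inherits badness, it cannot be its own witness; it is then
        -- already in `T`, because it meets the bad `i′`.
        ... | inj₁ (here refl) = inj₂ (i-covered (i′ ∈? A))
          where
          i-covered : Dec (i′ ∈ A) → i ∈ T ⊎ ∃ λ x → x ∈ S′ × x ∉ A′ × x ⊑ i
          i-covered (yes i′∈A) = inj₁ (paid i′∈A o∈O (#-sym i i′ (⊑⇒# i i′ i⊑i′)))
          i-covered (no i′∉A) = inj₂ (i , i∈S′ , i∉A′ i′∉A , id)
        ... | inj₂ (inj₂ (x , x∈S , x∉A , x⊑o)) with x ≟ i′
        ...   | yes refl = inj₂ (inj₂ (i , i∈S′ , i∉A′ x∉A , λ y∈i → x⊑o (i⊑i′ y∈i)))
        ...   | no x≢i′ = inj₂ (inj₂ (x , keep x∈S x≢i′ ,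
                  [ x∉A ∘ proj₁ , (λ { (refl , _) → i∉S x∈S }) ]′ ∘ A-cases , x⊑o))

        shrink : Next (S′ , M′)
        shrink = T , A′ , record
          { disjoint = disjoint′
          ; fresh    = fresh′
          ; A⊆S      = A′⊆S′
          ; A⊆M      = A′⊆M′
          ; paid     = paid′
          ; good     = good′
          ; covered  = covered′
          } , Paid-free T A A′ i ∣A∣≤∣A′∣

      -- Acceptance by revoking partial conflicts.

      module Revoke {Iₛ : Subset n}
        (Iₛ⁻ : ∀ {j} → j ∈ Iₛ → j ∈ S × i # j) (Iₛ⁺ : ∀ {j} → j ∈ S → i # j → j ∈ Iₛ)
        (partials : ∀ {j} → j ∈ Iₛ → PartialConflict (interval inst i) (interval inst j))
        (prd : Prd i ≡ true) (unmarked : ∀ {j} → j ∈ Iₛ → j ∉ M) where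

        S′ M′ : Subset n
        S′ = (S ∪ ⁅ i ⁆) ─ Iₛ
        M′ = M ∪ ⁅ i ⁆

        i∉Iₛ : i ∉ Iₛ
        i∉Iₛ i∈Iₛ = proj₁ (proj₂ (partials i∈Iₛ)) id

        i∉S : i ∉ S
        i∉S i∈S = i∉Iₛ (Iₛ⁺ i∈S (#-refl i))

        i∈S′ : i ∈ S′
        i∈S′ = x∈p∧x∉q⇒x∈p─q (q⊆p∪q S ⁅ i ⁆ (x∈⁅x⁆ i)) i∉Iₛ

        i∈M′ : i ∈ M′
        i∈M′ = q⊆p∪q M ⁅ i ⁆ (x∈⁅x⁆ i)

        keep : ∀ {x} → x ∈ S → x ∉ Iₛ → x ∈ S′
        keep x∈S x∉Iₛ = x∈p∧x∉q⇒x∈p─q (p⊆p∪q ⁅ i ⁆ x∈S) x∉Iₛ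

        S′-cases : ∀ {x} → x ∈ S′ → (x ∈ S × x ∉ Iₛ) ⊎ x ≡ i
        S′-cases x∈S′ with x∈p∪q⁻ S ⁅ i ⁆ (p─q⊆p (S ∪ ⁅ i ⁆) Iₛ x∈S′)
        ... | inj₁ x∈S = inj₁ (x∈S , x∈p─q⇒x∉q (S ∪ ⁅ i ⁆) Iₛ x∈S′)
        ... | inj₂ x∈i = inj₂ (x∈⁅y⁆⇒x≡y i x∈i)

        disjoint′ : PairwiseDisjoint inst S′
        disjoint′ {j} {k} j∈ k∈ j≢k j#k with S′-cases j∈ | S′-cases k∈
        ... | inj₁ (j∈S , _) | inj₁ (k∈S , _) = disjoint j∈S k∈S j≢k j#k
        ... | inj₁ (j∈S , j∉Iₛ) | inj₂ refl = j∉Iₛ (Iₛ⁺ j∈S (#-sym j i j#k))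
        ... | inj₂ refl | inj₁ (k∈S , k∉Iₛ) = k∉Iₛ (Iₛ⁺ k∈S j#k)
        ... | inj₂ refl | inj₂ refl = j≢k refl

        A⊆S′ : A ⊆ S′
        A⊆S′ x∈A = keep (A⊆S x∈A) λ x∈Iₛ → unmarked x∈Iₛ (A⊆M x∈A)

        M-cases : ∀ {x} → x ∈ M′ → x ∈ M ⊎ x ≡ i
        M-cases x∈M′ with x∈p∪q⁻ M ⁅ i ⁆ x∈M′
        ... | inj₁ x∈M = inj₁ x∈M
        ... | inj₂ x∈i = inj₂ (x∈⁅y⁆⇒x≡y i x∈i)

        good-old : ∀ {x} → x ≢ i → x ∈ S′ → x ∈ M′ → x ∉ A → ∃ λ o → o ∈ O × x ⊑ o
        good-old x≢i x∈S′ x∈M′ x∉A with S′-cases x∈S′ | M-cases x∈M′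
        ... | inj₂ x≡i | _ = contradiction x≡i x≢i
        ... | inj₁ _ | inj₂ x≡i = contradiction x≡i x≢i
        ... | inj₁ (x∈S , _) | inj₁ x∈M = good x∈S x∈M x∉A

        -- This controls the witnesses lost by revoking: if `x` was the witness of `o`, then `o`
        -- equals `i` when `i ∈ O`, and otherwise `o` is among the intervals that `i` pays for.
        Iₛ⊑⇒# : ∀ {x o} → x ∈ Iₛ → x ⊑ o → i # o
        Iₛ⊑⇒# {x} {o} x∈Iₛ x⊑o =
          #-sym o i (#-mono x o i x⊑o (#-sym i x (proj₂ (Iₛ⁻ x∈Iₛ))))

        module Right (i∈O : i ∈ O) where

          good′ : ∀ {x} → x ∈ S′ → x ∈ M′ → x ∉ A → ∃ λ o → o ∈ O × x ⊑ o
          good′ {x} x∈S′ x∈M′ x∉A with x ≟ i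
          ... | yes refl = i , i∈O , id
          ... | no x≢i = good-old x≢i x∈S′ x∈M′ x∉A

          covered′ : ∀ {o} → o ∈ O →
            o ∈ᴸ rest ⊎ o ∈ T ⊎ ∃ λ x → x ∈ S′ × x ∉ A × x ⊑ o
          covered′ o∈O with covered o∈O
          ... | inj₁ (here refl) = inj₂ (inj₂ (i , i∈S′ , i∉S ∘ A⊆S , id))
          ... | inj₁ (there o∈rest) = inj₁ o∈rest
          ... | inj₂ (inj₁ o∈T) = inj₂ (inj₁ o∈T)
          ... | inj₂ (inj₂ (x , x∈S , x∉A , x⊑o)) with x ∈? Iₛ
          ...   | no x∉Iₛ = inj₂ (inj₂ (x , keep x∈S x∉Iₛ , x∉A , x⊑o))
          -- A revoked witness would have to lie inside `i`, which a partial conflict excludes.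
          -- Revoking in favour of a member of `O` thus costs nothing.
          ...   | yes x∈Iₛ with refl ← disjoint⇒≡ O-disjoint i∈O o∈O (Iₛ⊑⇒# x∈Iₛ x⊑o) =
                  contradiction {A = x ⊑ i} x⊑o (proj₂ (proj₂ (partials x∈Iₛ)))

          revoke : Next (S′ , M′)
          revoke = T , A , record
            { disjoint = disjoint′
            ; fresh    = fresh-∪
            ; A⊆S      = A⊆S′
            ; A⊆M      = p⊆p∪q ⁅ i ⁆ ∘ A⊆M
            ; paid     = paid
            ; good     = good′
            ; covered  = covered′
            } , Paid-free T A A i ℕ.≤-refl

        module Wrong (i∉O : i ∉ O) where

          A′ T′ : Subset n
          A′ = A ∪ ⁅ i ⁆
          T′ = T ∪ conflictsIn inst O i

          T⊆T′ : T ⊆ T′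
          T⊆T′ = p⊆p∪q (conflictsIn inst O i)

          C⊆T′ : ∀ {o} → o ∈ O → i # o → o ∈ T′
          C⊆T′ o∈O i#o = q⊆p∪q T (conflictsIn inst O i) (∈-conflictsIn⁺ O i o∈O i#o)

          A-cases : ∀ {x} → x ∈ A′ → x ∈ A ⊎ x ≡ i
          A-cases x∈A′ with x∈p∪q⁻ A ⁅ i ⁆ x∈A′
          ... | inj₁ x∈A = inj₁ x∈A
          ... | inj₂ x∈i = inj₂ (x∈⁅y⁆⇒x≡y i x∈i)

          A′⊆S′ : A′ ⊆ S′
          A′⊆S′ x∈A′ with A-cases x∈A′
          ... | inj₁ x∈A = A⊆S′ x∈A
          ... | inj₂ refl = i∈S′

          A′⊆M′ : A′ ⊆ M′
          A′⊆M′ x∈A′ with A-cases x∈A′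
          ... | inj₁ x∈A = p⊆p∪q ⁅ i ⁆ (A⊆M x∈A)
          ... | inj₂ refl = i∈M′

          paid′ : ∀ {x o} → x ∈ A′ → o ∈ O → x # o → o ∈ T′
          paid′ x∈A′ o∈O x#o with A-cases x∈A′
          ... | inj₁ x∈A = T⊆T′ (paid x∈A o∈O x#o)
          ... | inj₂ refl = C⊆T′ o∈O x#o

          good′ : ∀ {x} → x ∈ S′ → x ∈ M′ → x ∉ A′ → ∃ λ o → o ∈ O × x ⊑ o
          good′ x∈S′ x∈M′ x∉A′ = good-old
            (λ { refl → x∉A′ (q⊆p∪q A ⁅ i ⁆ (x∈⁅x⁆ i)) }) x∈S′ x∈M′ (x∉A′ ∘ p⊆p∪q ⁅ i ⁆)

          covered′ : ∀ {o} → o ∈ O →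
            o ∈ᴸ rest ⊎ o ∈ T′ ⊎ ∃ λ x → x ∈ S′ × x ∉ A′ × x ⊑ o
          covered′ o∈O with covered o∈O
          ... | inj₁ (here refl) = contradiction o∈O i∉O
          ... | inj₁ (there o∈rest) = inj₁ o∈rest
          ... | inj₂ (inj₁ o∈T) = inj₂ (inj₁ (T⊆T′ o∈T))
          ... | inj₂ (inj₂ (x , x∈S , x∉A , x⊑o)) with x ∈? Iₛ
          ...   | yes x∈Iₛ = inj₂ (inj₁ (C⊆T′ o∈O (Iₛ⊑⇒# x∈Iₛ x⊑o)))
          ...   | no x∉Iₛ = inj₂ (inj₂ (x , keep x∈S x∉Iₛ ,
                    [ x∉A , (λ { refl → i∉S x∈S }) ]′ ∘ A-cases , x⊑o))

          revoke : Next (S′ , M′)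
          revoke = T′ , A′ , record
            { disjoint = disjoint′
            ; fresh    = fresh-∪
            ; A⊆S      = A′⊆S′
            ; A⊆M      = A′⊆M′
            ; paid     = paid′
            ; good     = good′
            ; covered  = covered′
            } , Paid-wrong T A i i∉O prd (i∉S ∘ A⊆S)

        revoke : Next (S′ , M′)
        revoke with i ∈? O
        ... | yes i∈O = Right.revoke i∈O
        ... | no i∉O = Wrong.revoke i∉O

      -- Rejection.

      reject-with : ∀ T′ → T ⊆ T′ → Paid (η i) T A T′ A →
        (i ∈ O → i ∈ T′ ⊎ ∃ λ x → x ∈ S × x ∉ A × x ⊑ i) → Next (S , M)
      reject-with T′ T⊆T′ cost i-covered = T′ , A , record
        { disjoint = disjoint
        ; fresh    = fresh ∘ there
        ; A⊆S      = A⊆S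
        ; A⊆M      = A⊆M
        ; paid     = λ x∈A o∈O x#o → T⊆T′ (paid x∈A o∈O x#o)
        ; good     = good
        ; covered  = covered′
        } , cost
        where
        covered′ : ∀ {o} → o ∈ O →
          o ∈ᴸ rest ⊎ o ∈ T′ ⊎ ∃ λ x → x ∈ S × x ∉ A × x ⊑ o
        covered′ o∈O with covered o∈O
        ... | inj₁ (here refl) = inj₂ (i-covered o∈O)
        ... | inj₁ (there o∈rest) = inj₁ o∈rest
        ... | inj₂ (inj₁ o∈T) = inj₂ (inj₁ (T⊆T′ o∈T))
        ... | inj₂ (inj₂ w) = inj₂ (inj₂ w)

      -- Only a rejected `i` in `O` needs care. If predicted 0, it is paid for by its own error. If
      -- predicted 1, it meets the member `j` of `obstacle`: a bad `j` means that `i` is already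
      -- paid for, and any other `j` lies inside `i`. For a marked `j` the latter holds since `good`
      -- places `j` inside an interval of `O`, which meets `i` and hence is `i`.
      reject : (Prd i ≡ true → ∃ λ j → j ∈ S × i # j × (j ⊑ i ⊎ j ∈ M)) → Next (S , M)
      reject obstacle = cases (Prd i) refl (i ∈? O)
        where
        i-covered : Prd i ≡ true → i ∈ O → i ∈ T ⊎ ∃ λ x → x ∈ S × x ∉ A × x ⊑ i
        i-covered prd i∈O with obstacle prd
        ... | j , j∈S , i#j , why with j ∈? A
        ...   | yes j∈A = inj₁ (paid j∈A i∈O (#-sym i j i#j))
        ...   | no j∉A with why
        ...     | inj₁ j⊑i = inj₂ (j , j∈S , j∉A , j⊑i)
        ...     | inj₂ j∈M with good j∈S j∈M j∉A
        ...       | o , o∈O , j⊑o with refl ← disjoint⇒≡ O-disjoint i∈O o∈O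
                      (#-sym o i (#-mono j o i j⊑o (#-sym i j i#j)))
                    = inj₂ (j , j∈S , j∉A , j⊑o)

        cases : ∀ b → Prd i ≡ b → Dec (i ∈ O) → Next (S , M)
        cases true prd _ = reject-with T id (Paid-free T A A i ℕ.≤-refl) (i-covered prd)
        cases false _ (no i∉O) = reject-with T id (Paid-free T A A i ℕ.≤-refl)
          λ i∈O → contradiction i∈O i∉O
        cases false ¬prd (yes i∈O) = reject-with (T ∪ ⁅ i ⁆) (p⊆p∪q ⁅ i ⁆)
          (Paid-missed T A i i∈O ¬prd) λ _ → inj₁ (q⊆p∪q T ⁅ i ⁆ (x∈⁅x⁆ i))

      -- Matching the rules of the algorithm with these cases.

      module Process (Iₛ : Subset n)
        (Iₛ⁻ : ∀ {j} → j ∈ Iₛ → j ∈ S × i # j) (Iₛ⁺ : ∀ {j} → j ∈ S → i # j → j ∈ Iₛ) where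

        -- Whatever meets `i` also meets the interval `j` around it, so disjointness of `S` leaves
        -- no second conflict. Failure of the inclusion rule therefore means that no member properly
        -- contains `i`.
        inside⇒unique : ∀ {j} → j ∈ S → i ⊑ j → ¬ j ⊑ i → InsideUnique inst Prd Iₛ i
        inside⇒unique {j} j∈S i⊑j j⋢i = j , ⊆-antisym fwd bwd , (λ {_} → i⊑j) , j⋢i
          where
          fwd : Iₛ ⊆ ⁅ j ⁆
          fwd {k} k∈Iₛ with k∈S , i#k ← Iₛ⁻ k∈Iₛ
            with refl ← disjoint⇒≡ disjoint j∈S k∈S (#-mono i j k i⊑j i#k) = x∈⁅x⁆ j

          bwd : ⁅ j ⁆ ⊆ Iₛ
          bwd k∈j with refl ← x∈⁅y⁆⇒x≡y j k∈j = Iₛ⁺ j∈S (⊑⇒# i j i⊑j)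

        -- If no conflicting member is marked and none lies inside `i`, then all conflicts are
        -- partial and the revoking rule would have applied.
        obstacle : ¬ InsideUnique inst Prd Iₛ i → ¬ Revoking inst Prd Iₛ M i →
          Prd i ≡ true → ∃ λ j → j ∈ S × i # j × (j ⊑ i ⊎ j ∈ M)
        obstacle ¬unique ¬revoking prd with nonempty? (Iₛ ∩ M)
        ... | yes (j , j∈) with j∈Iₛ , j∈M ← x∈p∩q⁻ Iₛ M j∈
          with j∈S , i#j ← Iₛ⁻ j∈Iₛ = j , j∈S , i#j , inj₂ j∈M
        ... | no unmarked with any? (λ j → j ∈? Iₛ ×-dec ⊆? (interval inst j) (interval inst i))
        ...   | yes (j , j∈Iₛ , j⊑i) with j∈S , i#j ← Iₛ⁻ j∈Iₛ = j , j∈S , i#j , inj₁ j⊑i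
        ...   | no none = contradiction
                  {A = Revoking inst Prd Iₛ M i} (partials , prd , unmarked) ¬revoking
          where
          partials : ∀ {j} → j ∈ Iₛ → PartialConflict (interval inst i) (interval inst j)
          partials {j} j∈Iₛ with j∈S , i#j ← Iₛ⁻ j∈Iₛ =
            i#j , (λ i⊑j → ¬unique (inside⇒unique j∈S i⊑j j⋢i)) , j⋢i
            where
            j⋢i : ¬ j ⊑ i
            j⋢i j⊑i = none (j , j∈Iₛ , j⊑i)

        process-invariant : Next (process inst Prd Iₛ (S , M) i)
        process-invariant with nonempty? Iₛ
        ... | no empty = accept λ j∈S i#j → empty (_ , Iₛ⁺ j∈S i#j)
        ... | yes _ with insideUnique? inst Prd Iₛ i
        -- Matching on `refl` is possible because `Iₛ` is a variable here, known only through its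
        -- membership conditions.
        ...   | yes (i′ , refl , i⊑i′ , i′⋢i) = Shrink.shrink (proj₁ (Iₛ⁻ (x∈⁅x⁆ i′))) i⊑i′ i′⋢i
                  λ j∈S i#j → x∈⁅y⁆⇒x≡y i′ (Iₛ⁺ j∈S i#j)
        ...   | no ¬unique with revoking? inst Prd Iₛ M i
        ...     | yes (partials , prd , unmarked) = Revoke.revoke Iₛ⁻ Iₛ⁺ partials prd
                    λ j∈Iₛ j∈M → unmarked (_ , x∈p∩q⁺ (j∈Iₛ , j∈M))
        ...     | no ¬revoking = reject (obstacle ¬unique ¬revoking)

    -- The complete run and the final count.

    run : ∀ {rest σ T A} → Unique rest → Invariant rest σ T A →
      ∃₂ λ T′ A′ → Invariant [] (foldl (arrive inst Prd) σ rest) T′ A′ ×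
                   Paid (listSum η rest) T A T′ A′
    run {[]} {T = T} {A} [] inv = T , A , inv , Paid-refl T A
    run {i ∷ rest} {S , M} {T} {A} (i∉rest ∷ unique) inv
      with Arrival.Process.process-invariant i∉rest inv (conflictsIn inst S i)
             (∈-conflictsIn⁻ S i) (∈-conflictsIn⁺ S i)
    ... | T₁ , A₁ , inv₁ , cost₁ with run unique inv₁
    ... | T₂ , A₂ , inv₂ , cost₂ =
      T₂ , A₂ , inv₂ , Paid-trans (η i) (listSum η rest) T A T₁ A₁ T₂ A₂ cost₁ cost₂

    initial : Invariant (allFin n) (⊥ , ⊥) ⊥ ⊥
    initial = record
      { disjoint = λ i∈⊥ → contradiction i∈⊥ ∉⊥
      ; fresh    = λ _ → ∉⊥
      ; A⊆S      = id
      ; A⊆M      = id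
      ; paid     = λ x∈⊥ → contradiction x∈⊥ ∉⊥
      ; good     = λ x∈⊥ → contradiction x∈⊥ ∉⊥
      ; covered  = λ {o} _ → inj₁ (∈-allFin o)
      }

    -- Split `O` along `T` and `S` along `A`. With no arrivals left, each interval of `O` outside
    -- `T` contains a member outside `A`, and these members are distinct because a member inside two
    -- intervals of `O` would make them conflict.
    ∣O∣-bound : ∀ {S M T A} → Invariant [] (S , M) T A →
      ∣ O ∣ ℕ.+ ∣ A ∣ ℕ.≤ ∣ T ∣ ℕ.+ ∣ S ∣
    ∣O∣-bound {S} {M} {T} {A} inv = begin
      ∣ O ∣ ℕ.+ ∣ A ∣                            ≡⟨ cong (ℕ._+ ∣ A ∣) (∣p∩q∣+∣p─q∣≡∣p∣ O T) ⟨
      ∣ O ∩ T ∣ ℕ.+ ∣ O ─ T ∣ ℕ.+ ∣ A ∣          ≤⟨ ℕ.+-mono-≤ (ℕ.+-mono-≤ (∣p∩q∣≤∣q∣ O T) O─T≤S─A) A≤S∩A ⟩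
      ∣ T ∣ ℕ.+ ∣ S ─ A ∣ ℕ.+ ∣ S ∩ A ∣          ≡⟨ ℕ.+-assoc ∣ T ∣ _ _ ⟩
      ∣ T ∣ ℕ.+ (∣ S ─ A ∣ ℕ.+ ∣ S ∩ A ∣)        ≡⟨ cong (∣ T ∣ ℕ.+_) (ℕ.+-comm ∣ S ─ A ∣ _) ⟩
      ∣ T ∣ ℕ.+ (∣ S ∩ A ∣ ℕ.+ ∣ S ─ A ∣)        ≡⟨ cong (∣ T ∣ ℕ.+_) (∣p∩q∣+∣p─q∣≡∣p∣ S A) ⟩
      ∣ T ∣ ℕ.+ ∣ S ∣                            ∎
      where
      open ℕ.≤-Reasoning
      open Invariant inv hiding (S; M)

      A≤S∩A : ∣ A ∣ ℕ.≤ ∣ S ∩ A ∣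
      A≤S∩A = p⊆q⇒∣p∣≤∣q∣ λ x∈A → x∈p∩q⁺ (A⊆S x∈A , x∈A)

      InO : Fin n → Fin n → Set _
      InO o x = o ∈ O × x ⊑ o

      InO-injective : ∀ {o o′ x} → InO o x → InO o′ x → o ≡ o′
      InO-injective {o} {o′} {x} (o∈O , x⊑o) (o′∈O , x⊑o′) =
        disjoint⇒≡ O-disjoint o∈O o′∈O (#-mono x o o′ x⊑o (⊑⇒# x o′ x⊑o′))

      member : ∀ {o} → o ∈ O ─ T → ∃ λ x → x ∈ S ─ A × InO o x
      member o∈ with o∈O ← p─q⊆p O T o∈ with covered o∈O
      ... | inj₂ (inj₁ o∈T) = contradiction o∈T (x∈p─q⇒x∉q O T o∈)
      ... | inj₂ (inj₂ (x , x∈S , x∉A , x⊑o)) =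
        x , x∈p∧x∉q⇒x∈p─q x∈S x∉A , o∈O , λ {_} → x⊑o

      O─T≤S─A : ∣ O ─ T ∣ ℕ.≤ ∣ S ─ A ∣
      O─T≤S─A = injection⇒∣p∣≤∣q∣ InO InO-injective (O ─ T) (S ─ A) member

theorem4p1 : ∀ {c ℓ₁ ℓ₂} (Line : StrictTotalOrder c ℓ₁ ℓ₂) (inst : Instance Line)
    (opt : ℤ) → IsOPT inst unit opt →
    (O : Subset (size inst)) → IsOptimal inst unit O →
    (Prd : Fin (size inst) → Bool) →
    PairwiseDisjoint inst (revokeUnit inst Prd)
    × weight unit (revokeUnit inst Prd) ≥ opt - error inst unit O Prd
theorem4p1 Line inst opt (P , (P-disjoint , _) , refl) O O-optimal Prd
  with run inst O O-optimal Prd (allFin⁺ (size inst)) (initial inst O O-optimal Prd)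
... | T , A , inv , cost = Invariant.disjoint inv , (begin
  -- `opt` is attained by some optimal `P`, possibly different from the reference solution `O`.
  weight unit P - η     ≤⟨ ℤ.+-monoˡ-≤ (- η) (proj₂ O-optimal P P-disjoint) ⟩
  weight unit O - η     ≡⟨ cong (_- η) (weight-unit O) ⟩
  + ∣ O ∣ - η           ≡⟨ lem₁ (+ ∣ O ∣) (+ ∣ A ∣) η ⟩
  (+ ∣ O ∣ + + ∣ A ∣) + (- (+ ∣ A ∣) - η)
    ≤⟨ ℤ.+-monoˡ-≤ (- (+ ∣ A ∣) - η) (+≤+ (∣O∣-bound inst O O-optimal Prd inv)) ⟩
  (+ ∣ T ∣ + + ∣ S ∣) + (- (+ ∣ A ∣) - η)
    ≡⟨ lem₂ (+ ∣ T ∣) (+ ∣ S ∣) (+ ∣ A ∣) η ⟩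
  (+ ∣ T ∣ + 0ℤ) + (+ ∣ S ∣ - + ∣ A ∣ - η)
    ≤⟨ ℤ.+-monoˡ-≤ (+ ∣ S ∣ - + ∣ A ∣ - η) cost′ ⟩
  (0ℤ + + ∣ A ∣ + η) + (+ ∣ S ∣ - + ∣ A ∣ - η)
    ≡⟨ lem₃ (+ ∣ A ∣) η (+ ∣ S ∣) ⟩
  + ∣ S ∣               ≡⟨ weight-unit S ⟨
  weight unit S         ∎)
  where
  open ℤ.≤-Reasoning
  S = revokeUnit inst Prd
  η = error inst unit O Prd

  cost′ : + ∣ T ∣ + 0ℤ ≤ 0ℤ + + ∣ A ∣ + η
  -- The run starts with both sets empty, so its balance amounts to `∣ T ∣ ≤ ∣ A ∣ + η`.
  cost′ = subst₂ (λ z e → + ∣ T ∣ + + z ≤ (+ z + + ∣ A ∣) + e)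
    (∣⊥∣≡0 (size inst)) (listSum-tabulate (errorAt inst unit O Prd) id) cost

  lem₁ : ∀ o a e → o - e ≡ (o + a) + (- a - e)
  lem₁ = solve-∀
  lem₂ : ∀ t s a e → (t + s) + (- a - e) ≡ (t + 0ℤ) + (s - a - e)
  lem₂ = solve-∀
  lem₃ : ∀ a e s → (0ℤ + a + e) + (s - a - e) ≡ s
  lem₃ = solve-∀
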